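{- Let $a_{n,k}^{\mathrm{pk}}(321)$ denote the number of permutations of $\{1,\dots,n\}$ that avoid the pattern $321$ and have exactly $k$ peaks. Then, as formal power series, $$\sum_{n \geq 0} \sum_{k \geq 0} a_{n,k}^{\mathrm{pk}}(321)\, q^k z^n = 1+z\left(-\dfrac{ -1+\sqrt{ -4z^2q+4z^2-4z+1}}{2z(zq-z+1)}\right)^2.$$
   Context: $\mathcal{S}_n$ is the set of permutations $\pi=\pi_1\cdots\pi_n$ of $\{1,\dots,n\}$; $\mathcal{S}_0$ consists of the empty permutation, which has $0$ peaks and avoids every nonempty pattern. For $\rho\in\mathcal{S}_m$, $\pi\in\mathcal{S}_n$ contains $\rho$ if there are indices $1\le i_1<\cdots<i_m\le n$ such that $\pi_{i_a}<\pi_{i_b}$ if and only if $\rho_a<\rho_b$; otherwise $\pi$ avoids $\rho$. The number of peaks is $\mathrm{pk}(\pi)=|\{i : \pi_i<\pi_{i+1}\text{ and }\pi_{i+1}>\pi_{i+2}\}|$, where $1\le i\le n-2$. The right-hand side is read as a formal power series in $z$ with coefficients in $\mathbb{Q}[q]$, where the square root is the one with constant term $1$. -}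

module Defs where

open import Algebra.Bundles.Raw using (RawRing)
import Algebra.Definitions.RawSemiring as RawSemiringDefinitions
open import Data.Fin using (Fin; zero; suc; inject₁; toℕ; _<_)
open import Data.Fin.Properties using (all?; any?; _≟_; _<?_)
open import Data.List using (List; []; _∷_; map; allFin; cartesianProductWith; filter; length)
open import Data.Nat using (ℕ; zero; suc; _∸_)
import Data.Nat.Properties as ℕ
open import Data.Product using (∃; _×_; _,_)
open import Data.Rational using (ℚ; +-*-rawRing)
open import Data.Vec using (Vec; []; _∷_; lookup)
open import Function using (_⇔_; mk⇔; Bijective)
open import Function.Bundles using (module Equivalence)
open import Level using (Level)
open import Relation.Binary.PropositionalEquality using (_≡_; refl)
open import Relation.Nullary using (Dec; ¬_; ¬?)
open import Relation.Nullary.Decidable using (map′; _×-dec_; _→-dec_)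
open import Relation.Unary using (Pred; Decidable)

private
  variable
    c ℓ : Level
    m n : ℕ

module Polynomial (R : RawRing c ℓ) where

  open RawRing R

  -- Coefficients in order of increasing degree.  Trailing zeros are
  -- allowed, so equality is equality of coefficients.
  Poly : Set c
  Poly = List Carrier

  coeff : Poly → ℕ → Carrier
  coeff []      _       = 0#
  coeff (a ∷ _) zero    = a
  coeff (_ ∷ p) (suc k) = coeff p k

  _+ₚ_ : Poly → Poly → Poly
  []      +ₚ r       = r
  (a ∷ p) +ₚ []      = a ∷ p
  (a ∷ p) +ₚ (b ∷ r) = (a + b) ∷ (p +ₚ r)

  _*ₚ_ : Poly → Poly → Poly
  []      *ₚ r = []
  (a ∷ p) *ₚ r = map (a *_) r +ₚ (0# ∷ (p *ₚ r))

  X : Poly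
  X = 0# ∷ 1# ∷ []

  rawRing : RawRing c ℓ
  rawRing = record
    { Carrier = Poly
    ; _≈_     = λ p r → ∀ k → coeff p k ≈ coeff r k
    ; _+_     = _+ₚ_
    ; _*_     = _*ₚ_
    ; -_      = map (-_)
    ; 0#      = []
    ; 1#      = 1# ∷ []
    }

module PowerSeries (R : RawRing c ℓ) where

  open RawRing R
  open RawSemiringDefinitions rawSemiring using (sum)

  Series : Set c
  Series = ℕ → Carrier

  constant : Carrier → Series
  constant a zero    = a
  constant a (suc _) = 0#

  X : Series
  X 1 = 1#
  X _ = 0#

  rawRing : RawRing c ℓ
  rawRing = record
    { Carrier = Series
    ; _≈_     = λ f g → ∀ n → f n ≈ g n
    ; _+_     = λ f g n → f n + g n
    ; _*_     = λ f g n → sum {suc n} λ i → f (toℕ i) * g (n ∸ toℕ i)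
    ; -_      = λ f n → - f n
    ; 0#      = constant 0#
    ; 1#      = constant 1#
    }

  -- Over a domain of characteristic different from 2, such as ℚ[q], at most
  -- one s satisfies s IsSqrtOf f.
  _IsSqrtOf_ : Series → Series → Set ℓ
  s IsSqrtOf f = (s 0 ≈ 1#) × (s ^ 2 ≈ₛ f)
    where
    open RawRing rawRing using () renaming (_≈_ to _≈ₛ_; rawSemiring to seriesRawSemiring)
    open RawSemiringDefinitions seriesRawSemiring using (_^_)

  -- g need not be invertible.  Over a domain, a quotient by a nonzero g is
  -- unique if it exists.
  _IsQuotientOf_By_ : Series → Series → Series → Set ℓ
  h IsQuotientOf f By g = (h *ₛ g) ≈ₛ f
    where open RawRing rawRing using () renaming (_≈_ to _≈ₛ_; _*_ to _*ₛ_)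

module ℚ[q] = Polynomial +-*-rawRing

module ℚ[q]⟦z⟧ where

  open PowerSeries ℚ[q].rawRing public
    using (Series; rawRing; constant; _IsSqrtOf_; _IsQuotientOf_By_)
  open RawRing rawRing public
    using (_≈_; _+_; _*_; -_; 0#; 1#)
  -- k × f is the k-fold sum f + ⋯ + f.
  open RawSemiringDefinitions (RawRing.rawSemiring rawRing) public
    using (_^_) renaming (_×_ to infixr 8 _·_)

  q z : Series
  q = constant ℚ[q].X
  z = PowerSeries.X ℚ[q].rawRing

  [z^_q^_]_ : ℕ → ℕ → Series → ℚ
  [z^ n q^ k ] f = ℚ[q].coeff (f n) k

-- Words of length m over {0, …, n - 1}; permutations of size n are
-- written in one-line notation with letters shifted down by one.
Word : ℕ → ℕ → Set
Word n m = Vec (Fin n) m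

IsPermutation : Word n n → Set
IsPermutation π = Bijective _≡_ _≡_ (lookup π)

IsOccurrence : Word m m → Word n n → Word n m → Set
IsOccurrence ρ π is =
  (∀ a b → a < b → lookup is a < lookup is b) ×
  (∀ a b → lookup π (lookup is a) < lookup π (lookup is b) ⇔ lookup ρ a < lookup ρ b)

_Contains_ : Word n n → Word m m → Set
π Contains ρ = ∃ λ is → IsOccurrence ρ π is

_Avoids_ : Word n n → Word m m → Set
π Avoids ρ = ¬ (π Contains ρ)

IsPeak : Word n (suc (suc m)) → Fin m → Set
IsPeak π i = (π₀ < π₁) × (π₂ < π₁)
  where
  π₀ = lookup π (inject₁ (inject₁ i))
  π₁ = lookup π (inject₁ (suc i))
  π₂ = lookup π (suc (suc i))

isPeak? : (π : Word n (suc (suc m))) → Decidable (IsPeak π)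
isPeak? π i = (_ <? _) ×-dec (_ <? _)

pk : Word n m → ℕ
pk {m = zero}        _ = 0
pk {m = suc zero}    _ = 0
pk {m = suc (suc m)} π = length (filter (isPeak? π) (allFin m))

isPermutation? : Decidable (IsPermutation {n})
isPermutation? π =
  map′ (λ inj {i} {j} → inj i j) (λ inj i j → inj {i} {j})
    (all? λ i → all? λ j → (lookup π i ≟ lookup π j) →-dec (i ≟ j))
  ×-dec
  all? λ y → map′ (λ (x , eq) → x , λ { refl → eq }) (λ (x , eq) → x , eq refl)
    (any? λ x → lookup π x ≟ y)

anyWord? : ∀ {p} {P : Pred (Word n m) p} → Decidable P → Dec (∃ P)
anyWord? {m = zero}  P? = map′ ([] ,_) (λ { ([] , p) → p }) (P? [])
anyWord? {m = suc m} P? =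
  map′ (λ (x , w , p) → x ∷ w , p) (λ { (x ∷ w , p) → x , w , p })
    (any? λ x → anyWord? λ w → P? (x ∷ w))

isOccurrence? : (ρ : Word m m) (π : Word n n) → Decidable (IsOccurrence ρ π)
isOccurrence? ρ π is =
  (all? λ a → all? λ b → (a <? b) →-dec (lookup is a <? lookup is b))
  ×-dec
  (all? λ a → all? λ b →
    map′ (λ (f , g) → mk⇔ f g) (λ e → Equivalence.to e , Equivalence.from e)
      (((_ <? _) →-dec (_ <? _)) ×-dec ((_ <? _) →-dec (_ <? _))))

_avoids?_ : (π : Word n n) (ρ : Word m m) → Dec (π Avoids ρ)
π avoids? ρ = ¬? (anyWord? (isOccurrence? ρ π))

words : ∀ n m → List (Word n m)
words n zero    = [] ∷ []
words n (suc m) = cartesianProductWith _∷_ (allFin n) (words n m)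

a^pk : Word m m → ℕ → ℕ → ℕ
a^pk ρ n k = length (filter counted? (words n n))
  where
  counted? : Decidable {A = Word n n} λ π → IsPermutation π × π Avoids ρ × pk π ≡ k
  counted? π = isPermutation? π ×-dec (π avoids? ρ) ×-dec (pk π ℕ.≟ k)

[321] : Word 3 3
[321] = suc (suc zero) ∷ suc zero ∷ zero ∷ []

{-# OPTIONS --safe #-}
module Submission where

open import Defs
open import Algebra.Bundles using (CommutativeRing)
open import Algebra.Bundles.Raw using (RawRing)
import Algebra.Definitions.RawSemiring as RawSemiringDefinitions
import Algebra.Morphism.RingMonomorphism as RingMonomorphism
open import Algebra.Morphism.Structures using (IsRingMonomorphism)
import Algebra.Properties.Ring as RingProperties
import Algebra.Solver.Ring.NaturalCoefficients.Default as SemiringSolver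
open import Algebra.Structures using (IsCommutativeRing)
open import Data.List using ([]; _∷_; map)
open import Data.Nat as ℕ using (ℕ; zero; suc; _≤_; z≤n; s≤s)
import Data.Nat.Properties as ℕ
open import Data.Product using (_×_; _,_; ∃-syntax)
open import Level using (Level)
import Relation.Binary.Reasoning.Setoid as ≈-Reasoning

-- Read a 321-avoiding permutation from left to right: every letter is either a
-- new maximum or the least unused letter, and a peak is a new maximum other than
-- the first letter which is followed by a smaller letter.  Hence the suffixes
-- which complete a prefix are counted by the number h of unused letters below
-- the maximum, the number r of unused letters above it, and whether the last
-- letter can still become a peak.  Let D h be the series in z (marking r) when
-- it cannot.  With v = 1 - z + z q the recurrences reduce to
--   D 0 = 1 + z D 1  and  D (h + 1) = z D (h + 2) + v D h,
-- so D (h + 1) = v C D h for C = D 0, and C = 1 + z v C².  All permutations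
-- together give 1 + z ∑ (z^h D h) = 1 + z C / (1 - z v C) = 1 + z C².  Finally
-- 1 - 2 z v C is the square root of 1 - 4 z v.

private
  variable
    a c ℓ : Level

-- Power series and polynomial rings

module PowerSeriesRing (R : CommutativeRing c ℓ) where

  open CommutativeRing R hiding (isCommutativeRing)
  open SemiringSolver commutativeSemiring
  open ≈-Reasoning setoid
  open PowerSeries rawRing using (Series; constant; X)
  private module S = RawRing (PowerSeries.rawRing rawRing)

  tail : Series → Series
  tail f n = f (suc n)

  constant-0# : ∀ n → constant 0# n ≈ 0#
  constant-0# zero    = refl
  constant-0# (suc n) = refl

  -- At `suc n` the product unfolds definitionally to `f 0 * g (suc n)` plus the coefficient of
  -- `tail f S.* g` at `n`. The ring laws below are inductions along this unfolding.
  *-cong′ : ∀ n {f f′ g g′} → f S.≈ f′ → g S.≈ g′ → (f S.* g) n ≈ (f′ S.* g′) n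
  *-cong′ zero    f≈ g≈ = +-congʳ (*-cong (f≈ 0) (g≈ 0))
  *-cong′ (suc n) f≈ g≈ =
    +-cong (*-cong (f≈ 0) (g≈ (suc n))) (*-cong′ n (λ k → f≈ (suc k)) g≈)

  -- The definitional unfolding splits off the first coefficient of the left factor. Commutativity
  -- compares it with this splitting on the right.
  *-unfoldʳ : ∀ n f g → (f S.* g) (suc n) ≈ (f S.* tail g) n + f (suc n) * g 0
  *-unfoldʳ zero f g =
    solve 2 (λ a b → a :+ (b :+ con 0) := (a :+ con 0) :+ b) refl (f 0 * g 1) (f 1 * g 0)
  *-unfoldʳ (suc n) f g = trans (+-congˡ (*-unfoldʳ n (tail f) g)) (sym (+-assoc _ _ _))

  *-comm′ : ∀ n f g → (f S.* g) n ≈ (g S.* f) n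
  *-comm′ zero f g = +-congʳ (*-comm _ _)
  *-comm′ (suc n) f g = begin
    f 0 * g (suc n) + (tail f S.* g) n  ≈⟨ +-cong (*-comm _ _) (*-comm′ n (tail f) g) ⟩
    g (suc n) * f 0 + (g S.* tail f) n  ≈⟨ +-comm _ _ ⟩
    (g S.* tail f) n + g (suc n) * f 0  ≈⟨ *-unfoldʳ n g f ⟨
    (g S.* f) (suc n)                   ∎

  *-distribʳ′ : ∀ n f g h → ((g S.+ h) S.* f) n ≈ (g S.* f) n + (h S.* f) n
  *-distribʳ′ zero f g h =
    solve 3 (λ a b c → (b :+ c) :* a :+ con 0 := (b :* a :+ con 0) :+ (c :* a :+ con 0))
      refl (f 0) (g 0) (h 0)
  *-distribʳ′ (suc n) f g h = trans (+-congˡ (*-distribʳ′ n f (tail g) (tail h)))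
    (solve 5 (λ a b c x y → (b :+ c) :* a :+ (x :+ y) := (b :* a :+ x) :+ (c :* a :+ y))
      refl (f (suc n)) (g 0) (h 0) ((tail g S.* f) n) ((tail h S.* f) n))

  scale-* : ∀ n a f g → ((λ k → a * f k) S.* g) n ≈ a * (f S.* g) n
  scale-* zero a f g =
    solve 3 (λ a x y → a :* x :* y :+ con 0 := a :* (x :* y :+ con 0)) refl a (f 0) (g 0)
  scale-* (suc n) a f g = trans (+-congˡ (scale-* n a (tail f) g))
    (solve 4 (λ a x y t → a :* x :* y :+ a :* t := a :* (x :* y :+ t))
      refl a (f 0) (g (suc n)) ((tail f S.* g) n))

  -- The tail of `f S.* g` is `f 0` times `tail g` plus `tail f S.* g`, so distributivity and
  -- scaling reduce the claim to `tail f`.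
  *-assoc′ : ∀ n f g h → ((f S.* g) S.* h) n ≈ (f S.* (g S.* h)) n
  *-assoc′ zero f g h =
    solve 3 (λ a b c → (a :* b :+ con 0) :* c :+ con 0 := a :* (b :* c :+ con 0) :+ con 0)
      refl (f 0) (g 0) (h 0)
  *-assoc′ (suc n) f g h = begin
    (f 0 * g 0 + 0#) * h (suc n) + (((λ k → f 0 * tail g k) S.+ (tail f S.* g)) S.* h) n
      ≈⟨ +-congˡ (*-distribʳ′ n h (λ k → f 0 * tail g k) (tail f S.* g)) ⟩
    (f 0 * g 0 + 0#) * h (suc n) + (((λ k → f 0 * tail g k) S.* h) n + ((tail f S.* g) S.* h) n)
      ≈⟨ +-congˡ (+-cong (scale-* n (f 0) (tail g) h) (*-assoc′ n (tail f) g h)) ⟩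
    (f 0 * g 0 + 0#) * h (suc n) + (f 0 * (tail g S.* h) n + (tail f S.* (g S.* h)) n)
      ≈⟨ solve 5 (λ a b c x y →
           (a :* b :+ con 0) :* c :+ (a :* x :+ y) := a :* (b :* c :+ x) :+ y)
           refl (f 0) (g 0) (h (suc n)) ((tail g S.* h) n) ((tail f S.* (g S.* h)) n) ⟩
    f 0 * (g 0 * h (suc n) + (tail g S.* h) n) + (tail f S.* (g S.* h)) n ∎

  0-* : ∀ n f → ((λ _ → 0#) S.* f) n ≈ 0#
  0-* zero    f = trans (+-identityʳ _) (zeroˡ _)
  0-* (suc n) f = trans (+-cong (zeroˡ _) (0-* n f)) (+-identityˡ _)

  constant-* : ∀ a f n → (constant a S.* f) n ≈ a * f n
  constant-* a f zero    = +-identityʳ _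
  constant-* a f (suc n) = trans (+-congˡ (0-* n f)) (+-identityʳ _)

  X-*-zero : ∀ f → (X S.* f) 0 ≈ 0#
  X-*-zero f = trans (+-identityʳ _) (zeroˡ _)

  X-*-suc : ∀ f n → (X S.* f) (suc n) ≈ f n
  X-*-suc f n = begin
    0# * f (suc n) + (tail X S.* f) n  ≈⟨ +-cong (zeroˡ _) (*-cong′ n {g = f} tail-X (λ _ → refl)) ⟩
    0# + (constant 1# S.* f) n         ≈⟨ +-identityˡ _ ⟩
    (constant 1# S.* f) n              ≈⟨ constant-* 1# f n ⟩
    1# * f n                           ≈⟨ *-identityˡ _ ⟩
    f n                                ∎
    where
    tail-X : tail X S.≈ constant 1#
    tail-X zero    = refl
    tail-X (suc k) = refl

  isCommutativeRing : IsCommutativeRing S._≈_ S._+_ S._*_ S.-_ S.0# S.1#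
  isCommutativeRing = record
    { isRing = record
      { +-isAbelianGroup = record
        { isGroup = record
          { isMonoid = record
            { isSemigroup = record
              { isMagma = record
                { isEquivalence = record
                  { refl  = λ n → refl
                  ; sym   = λ f≈g n → sym (f≈g n)
                  ; trans = λ f≈g g≈h n → trans (f≈g n) (g≈h n)
                  }
                ; ∙-cong = λ f≈ g≈ n → +-cong (f≈ n) (g≈ n)
                }
              ; assoc = λ f g h n → +-assoc _ _ _
              }
            ; identity =
                (λ f n → trans (+-congʳ (constant-0# n)) (+-identityˡ _)) ,
                (λ f n → trans (+-congˡ (constant-0# n)) (+-identityʳ _))
            }
          ; inverse =
              (λ f n → trans (-‿inverseˡ _) (sym (constant-0# n))) ,
              (λ f n → trans (-‿inverseʳ _) (sym (constant-0# n)))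
          ; ⁻¹-cong = λ f≈ n → -‿cong (f≈ n)
          }
        ; comm = λ f g n → +-comm _ _
        }
      ; *-cong = λ f≈ g≈ n → *-cong′ n f≈ g≈
      ; *-assoc = λ f g h n → *-assoc′ n f g h
      ; *-identity =
          1-* , (λ f n → trans (*-comm′ n f (constant 1#)) (1-* f n))
      ; distrib =
          (λ f g h n → begin
            (f S.* (g S.+ h)) n          ≈⟨ *-comm′ n f (g S.+ h) ⟩
            ((g S.+ h) S.* f) n          ≈⟨ *-distribʳ′ n f g h ⟩
            (g S.* f) n + (h S.* f) n    ≈⟨ +-cong (*-comm′ n g f) (*-comm′ n h f) ⟩
            (f S.* g) n + (f S.* h) n    ∎) ,
          (λ f g h n → *-distribʳ′ n f g h)
      }
    ; *-comm = λ f g n → *-comm′ n f g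
    }
    where
    1-* : ∀ f → (constant 1# S.* f) S.≈ f
    1-* f n = trans (constant-* 1# f n) (*-identityˡ _)

  commutativeRing : CommutativeRing c ℓ
  commutativeRing = record { isCommutativeRing = isCommutativeRing }

module PolynomialRing (R : CommutativeRing c ℓ) where

  open CommutativeRing R hiding (isCommutativeRing)
  open RingProperties ring using (-0#≈0#)
  open ≈-Reasoning setoid
  open Polynomial rawRing using (coeff; X)
  open PowerSeries rawRing using (constant)
  private
    module P = RawRing (Polynomial.rawRing rawRing)
    module S = RawRing (PowerSeries.rawRing rawRing)
    module Series = PowerSeriesRing R

  coeff-+ : ∀ p r → coeff (p P.+ r) S.≈ (coeff p S.+ coeff r)
  coeff-+ []      r       n       = sym (+-identityˡ _)
  coeff-+ (a ∷ p) []      n       = sym (+-identityʳ _)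
  coeff-+ (a ∷ p) (b ∷ r) zero    = refl
  coeff-+ (a ∷ p) (b ∷ r) (suc n) = coeff-+ p r n

  coeff-scale : ∀ a p n → coeff (map (a *_) p) n ≈ a * coeff p n
  coeff-scale a []      n       = sym (zeroʳ _)
  coeff-scale a (b ∷ p) zero    = refl
  coeff-scale a (b ∷ p) (suc n) = coeff-scale a p n

  coeff-- : ∀ p → coeff (P.- p) S.≈ (S.- coeff p)
  coeff-- []      n       = sym -0#≈0#
  coeff-- (b ∷ p) zero    = refl
  coeff-- (b ∷ p) (suc n) = coeff-- p n

  coeff-* : ∀ p r → coeff (p P.* r) S.≈ (coeff p S.* coeff r)
  coeff-* []      r n    = sym (Series.0-* n (coeff r))
  coeff-* (a ∷ p) r zero = begin
    coeff (map (a *_) r P.+ (0# ∷ (p P.* r))) 0  ≈⟨ coeff-+ (map (a *_) r) _ 0 ⟩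
    coeff (map (a *_) r) 0 + 0#                  ≈⟨ +-congʳ (coeff-scale a r 0) ⟩
    a * coeff r 0 + 0#                           ∎
  coeff-* (a ∷ p) r (suc n) = begin
    coeff (map (a *_) r P.+ (0# ∷ (p P.* r))) (suc n)  ≈⟨ coeff-+ (map (a *_) r) _ (suc n) ⟩
    coeff (map (a *_) r) (suc n) + coeff (p P.* r) n
      ≈⟨ +-cong (coeff-scale a r (suc n)) (coeff-* p r n) ⟩
    a * coeff r (suc n) + (coeff p S.* coeff r) n      ∎

  coeff-1# : coeff P.1# S.≈ S.1#
  coeff-1# zero    = refl
  coeff-1# (suc n) = refl

  -- Polynomials are equal by definition when their coefficient series are, so injectivity is
  -- immediate and the ring laws are pulled back from power series.
  coeff-isRingMonomorphism :
    IsRingMonomorphism (Polynomial.rawRing rawRing) (PowerSeries.rawRing rawRing) coeff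
  coeff-isRingMonomorphism = record
    { isRingHomomorphism = record
      { isSemiringHomomorphism = record
        { isNearSemiringHomomorphism = record
          { +-isMonoidHomomorphism = record
            { isMagmaHomomorphism = record
              { isRelHomomorphism = record { cong = λ p≈r → p≈r }
              ; homo = coeff-+
              }
            ; ε-homo = λ n → sym (Series.constant-0# n)
            }
          ; *-homo = coeff-*
          }
        ; 1#-homo = coeff-1#
        }
      ; -‿homo = coeff--
      }
    ; injective = λ p≈r → p≈r
    }

  commutativeRing : CommutativeRing c ℓ
  commutativeRing = record
    { isCommutativeRing =
        RingMonomorphism.isCommutativeRing coeff-isRingMonomorphism Series.isCommutativeRing
    }

  coeff-X-* : ∀ p → coeff (X P.* p) S.≈ coeff (0# ∷ p)
  coeff-X-* p zero = trans (coeff-* X p 0) (trans (+-identityʳ _) (zeroˡ _))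
  coeff-X-* p (suc n) = begin
    coeff (X P.* p) (suc n)                               ≈⟨ coeff-* X p (suc n) ⟩
    0# * coeff p (suc n) + (coeff (1# ∷ []) S.* coeff p) n
      ≈⟨ +-cong (zeroˡ _) (Series.*-cong′ n {g = coeff p} coeff-1# (λ _ → refl)) ⟩
    0# + (constant 1# S.* coeff p) n                      ≈⟨ +-identityˡ _ ⟩
    (constant 1# S.* coeff p) n                           ≈⟨ Series.constant-* 1# (coeff p) n ⟩
    1# * coeff p n                                        ≈⟨ *-identityˡ _ ⟩
    coeff p n                                             ∎

-- The quadratic equation of the generating function

module QuadraticEquation (R : CommutativeRing c ℓ) where

  open CommutativeRing R
  open RingProperties ring
  open RawSemiringDefinitions (RawRing.rawSemiring rawRing) using (_^_) renaming (_×_ to infixr 8 _·_)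
  open SemiringSolver commutativeSemiring
  open ≈-Reasoning setoid

  -- The semiring solver knows no subtraction, so the bracket is treated as an atom `v` elsewhere
  -- and its value enters through this relation.
  v+z≈1+zq : ∀ q z → (z * q + - z + 1#) + z ≈ 1# + z * q
  v+z≈1+zq q z = begin
    (z * q + - z + 1#) + z
      ≈⟨ solve 3 (λ x z⁻ z → (x :+ z⁻ :+ con 1) :+ z := (con 1 :+ x) :+ (z :+ z⁻))
           refl (z * q) (- z) z ⟩
    (1# + z * q) + (z + - z)  ≈⟨ +-congˡ (-‿inverseʳ z) ⟩
    (1# + z * q) + 0#         ≈⟨ +-identityʳ _ ⟩
    1# + z * q                ∎

  module _ (q z C : Carrier) (C-eq : C ≈ 1# + z * ((z * q + - z + 1#) * C * C)) where

    private
      v = z * q + - z + 1#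
      t = 2 · (z * (v * C))

      -- The trailing `con 1` mirrors the unfolding of `x ^ 2` to `x * (x * 1#)`.
      sq : ∀ {n} → Polynomial n → Polynomial n
      sq x = x :* (x :* con 1)

    √Δ : Carrier
    √Δ = 1# + - t

    -- The square is completed with both sides moved so that no subtraction
    -- is left for the semiring solver.
    √Δ²≈Δ : √Δ ^ 2 ≈ - (4 · (z ^ 2 * q)) + 4 · (z ^ 2) + - (4 · z) + 1#
    √Δ²≈Δ = +-cancelˡ (4 · (z ^ 2 * q) + 4 · z) _ _ (trans lhs (sym rhs))
      where
      -t*-t≈t*t : - t * - t ≈ t * t
      -t*-t≈t*t = begin
        - t * - t      ≈⟨ -‿distribˡ-* t (- t) ⟨
        - (t * - t)    ≈⟨ -‿cong (-‿distribʳ-* t t) ⟨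
        - (- (t * t))  ≈⟨ -‿involutive (t * t) ⟩
        t * t          ∎

      -- This is `C-eq` multiplied by 4 z v, since t² = 4 z v (z v C²) and 2 t = 4 z v C.
      t²+4zv≈2t : t * t + 4 · (z * v) ≈ 2 · t
      t²+4zv≈2t = begin
        t * t + 4 · (z * v)
          ≈⟨ solve 3 (λ z v C → let t = 2 :× (z :* (v :* C)) in
               t :* t :+ 4 :× (z :* v) := 4 :× (z :* (v :* (con 1 :+ z :* (v :* C :* C)))))
               refl z v C ⟩
        4 · (z * (v * (1# + z * (v * C * C))))
          -- A multiple by 4 is a fourfold sum ending in `0#`, and `e` rewrites each summand.
          ≈⟨ +-cong e (+-cong e (+-cong e (+-congʳ e))) ⟩
        4 · (z * (v * C))
          ≈⟨ solve 1 (λ x → 4 :× x := 2 :× (2 :× x)) refl (z * (v * C)) ⟩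
        2 · t ∎
        where
        e : z * (v * (1# + z * (v * C * C))) ≈ z * (v * C)
        e = *-congˡ (*-congˡ (sym C-eq))

      lhs : (4 · (z ^ 2 * q) + 4 · z) + √Δ ^ 2 ≈ 4 · (z ^ 2) + 1#
      lhs = begin
        (4 · (z ^ 2 * q) + 4 · z) + √Δ ^ 2
          ≈⟨ solve 3 (λ z q n →
               (4 :× (sq z :* q) :+ 4 :× z) :+ sq (con 1 :+ n)
                 := 4 :× z :* (con 1 :+ z :* q) :+ (n :* n :+ (con 1 :+ 2 :× n)))
               refl z q (- t) ⟩
        4 · z * (1# + z * q) + (- t * - t + (1# + 2 · (- t)))
          -- Replacing 1 + z q by `v + z` produces the 4 z v that combines with t² to 2 t.
          ≈⟨ +-cong (*-congˡ (sym (v+z≈1+zq q z))) (+-congʳ -t*-t≈t*t) ⟩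
        4 · z * (v + z) + (t * t + (1# + 2 · (- t)))
          ≈⟨ solve 4 (λ z v t n →
               4 :× z :* (v :+ z) :+ (t :* t :+ (con 1 :+ 2 :× n))
                 := 4 :× sq z :+ con 1 :+ 2 :× n :+ (t :* t :+ 4 :× (z :* v)))
               refl z v t (- t) ⟩
        4 · (z ^ 2) + 1# + 2 · (- t) + (t * t + 4 · (z * v))
          ≈⟨ +-congˡ t²+4zv≈2t ⟩
        4 · (z ^ 2) + 1# + 2 · (- t) + 2 · t
          ≈⟨ solve 3 (λ x t n → x :+ con 1 :+ 2 :× n :+ 2 :× t := x :+ con 1 :+ 2 :× (t :+ n))
               refl (4 · (z ^ 2)) t (- t) ⟩
        4 · (z ^ 2) + 1# + 2 · (t + - t)
          ≈⟨ +-congˡ (+-cong (-‿inverseʳ t) (+-congʳ (-‿inverseʳ t))) ⟩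
        4 · (z ^ 2) + 1# + 2 · 0#
          ≈⟨ solve 1 (λ x → x :+ con 1 :+ 2 :× con 0 := x :+ con 1) refl (4 · (z ^ 2)) ⟩
        4 · (z ^ 2) + 1# ∎

      rhs : (4 · (z ^ 2 * q) + 4 · z) +
            (- (4 · (z ^ 2 * q)) + 4 · (z ^ 2) + - (4 · z) + 1#) ≈ 4 · (z ^ 2) + 1#
      rhs = begin
        (x + u) + (- x + y + - u + 1#)
          ≈⟨ solve 5 (λ x x⁻ y u u⁻ →
               (x :+ u) :+ (x⁻ :+ y :+ u⁻ :+ con 1) := (x :+ x⁻) :+ (u :+ u⁻) :+ (y :+ con 1))
               refl x (- x) y u (- u) ⟩
        (x + - x) + (u + - u) + (y + 1#)
          ≈⟨ +-congʳ (+-cong (-‿inverseʳ x) (-‿inverseʳ u)) ⟩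
        0# + 0# + (y + 1#)
          ≈⟨ trans (+-congʳ (+-identityˡ 0#)) (+-identityˡ _) ⟩
        y + 1# ∎
        where
        x = 4 · (z ^ 2 * q)
        y = 4 · (z ^ 2)
        u = 4 · z

    -C*2zv≈√Δ-1 : - C * (2 · (z * v)) ≈ - 1# + √Δ
    -C*2zv≈√Δ-1 = begin
      - C * (2 · (z * v))    ≈⟨ -‿distribˡ-* _ _ ⟨
      - (C * (2 · (z * v)))  ≈⟨ -‿cong (solve 3 (λ z v C →
                                  C :* (2 :× (z :* v)) := 2 :× (z :* (v :* C))) refl z v C) ⟩
      - t                    ≈⟨ +-identityˡ _ ⟨
      0# + - t               ≈⟨ +-congʳ (-‿inverseˡ 1#) ⟨
      (- 1# + 1#) + - t      ≈⟨ +-assoc _ _ _ ⟩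
      - 1# + √Δ              ∎

    -- The inner sign comes from the quotient being `- C`, the outer one from the closed formula.
    1+zCC≈1+z[-[-C]]² : 1# + (z * C) * C ≈ 1# + z * (- (- C)) ^ 2
    1+zCC≈1+z[-[-C]]² = +-congˡ (begin
      (z * C) * C        ≈⟨ solve 2 (λ z C → z :* C :* C := z :* sq C) refl z C ⟩
      z * C ^ 2          ≈⟨ *-congˡ (*-cong neg²≈id (*-congʳ neg²≈id)) ⟨
      z * (- (- C)) ^ 2  ∎)
      where
      neg²≈id : - (- C) ≈ C
      neg²≈id = -‿involutive C

-- A new maximum after the first letter leads to rising: if a smaller letter
-- follows, then that maximum is a peak.
data Phase : Set where
  initial falling rising : Phase

-- The first letter has no left neighbour and is never a peak, so it leads to `falling`.
afterMax : Phase → Phase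
afterMax initial   = falling
afterMax falling = rising
afterMax rising  = rising

-- completions φ h r weighs the ways to complete a prefix which leaves h letters
-- below its maximum and r letters above it unused.  The next letter is the
-- least unused one (viaMin) or a new maximum (viaMax).
module Completions {A : Set a} (0ᴬ 1ᴬ : A) (_+ᴬ_ : A → A → A) (peak : A → A) where

  weigh : Phase → A → A
  weigh initial   x = x
  weigh falling x = x
  weigh rising  x = peak x

  mutual

    completions : Phase → ℕ → ℕ → A
    completions φ h r = viaMin φ h r +ᴬ viaMax (afterMax φ) h r

    viaMin : Phase → ℕ → ℕ → A
    -- The empty completion is counted here, when no letter is left.
    viaMin φ zero    zero    = 1ᴬ
    viaMin φ zero    (suc r) = 0ᴬ
    -- A peak is weighed only when the smaller letter after it is read.
    viaMin φ (suc h) r       = weigh φ (completions falling h r)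

    viaMax : Phase → ℕ → ℕ → A
    viaMax φ h zero    = 0ᴬ
    viaMax φ h (suc r) = completions φ h r +ᴬ viaMax φ (suc h) r

-- Generating series of the completions

module CompletionSeries (P : CommutativeRing c ℓ) (q₀ : CommutativeRing.Carrier P) where

  private module P = CommutativeRing P
  open PowerSeriesRing P renaming (commutativeRing to seriesRing)
  open CommutativeRing seriesRing
  open PowerSeries P.rawRing using (Series; constant) renaming (X to z)
  open QuadraticEquation seriesRing using (v+z≈1+zq)
  open SemiringSolver commutativeSemiring
  open ≈-Reasoning setoid
  open Completions P.0# P.1# P._+_ (q₀ P.*_)

  -- Agreement up to degree `n`. A factor `z` gains one degree, which makes induction on `n`
  -- possible.
  _≈[_]_ : Series → ℕ → Series → Set ℓ
  f ≈[ n ] g = ∀ {k} → k ≤ n → f k P.≈ g k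

  *-cong-≈[] : ∀ n f {g g′} → g ≈[ n ] g′ → (f * g) ≈[ n ] (f * g′)
  *-cong-≈[] n f g≈ {zero} k≤n = P.+-congʳ (P.*-congˡ (g≈ k≤n))
  *-cong-≈[] (suc n) f g≈ {suc k} (s≤s k≤n) = P.+-cong (P.*-congˡ (g≈ (s≤s k≤n)))
    (*-cong-≈[] n (tail f) (λ k′≤n → g≈ (ℕ.m≤n⇒m≤1+n k′≤n)) k≤n)

  z*-cong-≈[] : ∀ n {g g′} → g ≈[ n ] g′ → (z * g) ≈[ suc n ] (z * g′)
  z*-cong-≈[] n {g} {g′} g≈ {zero}  _         = P.trans (X-*-zero g) (P.sym (X-*-zero g′))
  z*-cong-≈[] n {g} {g′} g≈ {suc k} (s≤s k≤n) =
    P.trans (X-*-suc g k) (P.trans (g≈ k≤n) (P.sym (X-*-suc g′ k)))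

  private
    q v : Series
    q = constant q₀
    v = z * q + - z + 1#

    C : Series
    C = completions falling 0

    D S : ℕ → Series
    D = completions falling
    S = viaMax rising

  viaMin-zero : ∀ φ → viaMin φ 0 ≈ 1#
  viaMin-zero φ zero    = P.refl
  viaMin-zero φ (suc r) = P.refl

  completions-zero : ∀ φ → completions φ 0 ≈ 1# + viaMax (afterMax φ) 0
  completions-zero φ = +-congʳ (viaMin-zero φ)

  completions-rising : ∀ h → completions rising (suc h) ≈ q * D h + S (suc h)
  completions-rising h = +-congʳ (λ r → P.sym (constant-* q₀ (D h) r))

  viaMax-step : ∀ φ h → viaMax φ h ≈ z * (completions φ h + viaMax φ (suc h))
  viaMax-step φ h zero    = P.sym (X-*-zero (completions φ h + viaMax φ (suc h)))
  viaMax-step φ h (suc r) = P.sym (X-*-suc (completions φ h + viaMax φ (suc h)) r)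

  D-zero : D 0 ≈ 1# + z * D 1
  D-zero = begin
    D 0                                  ≈⟨ completions-zero falling ⟩
    1# + S 0                             ≈⟨ +-congˡ (viaMax-step rising 0) ⟩
    1# + z * (completions rising 0 + S 1)
      -- For `h = 0` no smaller letter can follow, so `rising` and `falling` have the same
      -- completions; moreover `D 1` is `D 0 + S 1` by definition.
      ≈⟨ +-congˡ (*-congˡ {x = z} (+-congʳ (trans (completions-zero rising) (sym (completions-zero falling))))) ⟩
    1# + z * D 1                         ∎

  -- By definition `D (suc h)` is `D h + S (suc h)`. After one unfolding of `S`, writing 1 + z q as
  -- `v + z` frees the term `z * D h` that completes the two remaining values of `S` to
  -- `D (suc (suc h))`.
  D-suc : ∀ h → D (suc h) ≈ z * D (suc (suc h)) + v * D h
  D-suc h = begin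
    D h + S (suc h)
      ≈⟨ +-congˡ (viaMax-step rising (suc h)) ⟩
    D h + z * (completions rising (suc h) + S (suc (suc h)))
      ≈⟨ +-congˡ (*-congˡ {x = z} (+-congʳ (completions-rising h))) ⟩
    D h + z * ((q * D h + S (suc h)) + S (suc (suc h)))
      ≈⟨ solve 5 (λ d q z s s′ → d :+ z :* ((q :* d :+ s) :+ s′)
           := (con 1 :+ z :* q) :* d :+ z :* (s :+ s′))
           refl (D h) q z (S (suc h)) (S (suc (suc h))) ⟩
    (1# + z * q) * D h + z * (S (suc h) + S (suc (suc h)))
      ≈⟨ +-congʳ (*-congʳ (sym (v+z≈1+zq q z))) ⟩
    (v + z) * D h + z * (S (suc h) + S (suc (suc h)))
      ≈⟨ solve 5 (λ d v z s s′ → (v :+ z) :* d :+ z :* (s :+ s′)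
           := z :* ((d :+ s) :+ s′) :+ v :* d)
           refl (D h) v z (S (suc h)) (S (suc (suc h))) ⟩
    z * D (suc (suc h)) + v * D h ∎

  -- Lexicographic induction: D-zero and D-suc express D through a term with a
  -- factor z and one with a smaller h, and both sides satisfy them.
  mutual

    D-geometric-≈[] : ∀ n h → D (suc h) ≈[ n ] ((v * C) * D h)
    D-geometric-≈[] n zero {k} k≤n = P.trans (D-suc 0 k)
      (P.trans (P.+-congʳ (zD-geometric-≈[] n 0 k≤n)) (sym split k))
      where
      split : (v * C) * D 0 ≈ z * ((v * C) * D 1) + v * C
      split = begin
        (v * C) * D 0            ≈⟨ *-congˡ {x = v * C} D-zero ⟩
        (v * C) * (1# + z * D 1)
          ≈⟨ solve 3 (λ w z d → w :* (con 1 :+ z :* d) := z :* (w :* d) :+ w) refl (v * C) z (D 1) ⟩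
        z * ((v * C) * D 1) + v * C ∎
    D-geometric-≈[] n (suc h) {k} k≤n = P.trans (D-suc (suc h) k)
      (P.trans
        (P.+-cong (zD-geometric-≈[] n (suc h) k≤n) (*-cong-≈[] n v (D-geometric-≈[] n h) k≤n))
        (sym split k))
      where
      w = v * C
      split : w * D (suc h) ≈ z * (w * D (suc (suc h))) + v * (w * D h)
      split = begin
        w * D (suc h)                               ≈⟨ *-congˡ {x = w} (D-suc h) ⟩
        w * (z * D (suc (suc h)) + v * D h)
          ≈⟨ solve 5 (λ w z v d₀ d₂ → w :* (z :* d₂ :+ v :* d₀) := z :* (w :* d₂) :+ v :* (w :* d₀))
               refl w z v (D h) (D (suc (suc h))) ⟩
        z * (w * D (suc (suc h))) + v * (w * D h)   ∎

    zD-geometric-≈[] : ∀ n h → (z * D (suc (suc h))) ≈[ n ] (z * ((v * C) * D (suc h)))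
    zD-geometric-≈[] zero    h z≤n =
      P.trans (X-*-zero (D (suc (suc h)))) (P.sym (X-*-zero ((v * C) * D (suc h))))
    zD-geometric-≈[] (suc n) h = z*-cong-≈[] n (D-geometric-≈[] n (suc h))

  D-geometric : ∀ h → D (suc h) ≈ (v * C) * D h
  D-geometric h n = D-geometric-≈[] n h ℕ.≤-refl

  C-eq : C ≈ 1# + z * (v * C * C)
  C-eq = trans D-zero (+-congˡ (*-congˡ {x = z} (D-geometric 0)))

  -- Iterating `viaMax-step` gives the geometric series z D h / (1 - z v C), and `C-eq` says that
  -- the inverse of 1 - z v C is C. Instead of inverting, the closed form is checked against the
  -- recurrence by induction on the degree, for all `h` at once.
  viaMax-falling : ∀ n h → viaMax falling h n P.≈ ((z * C) * D h) n
  viaMax-falling n h = P.trans (step n h) (split h n)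
    where
    split : ∀ h → z * (D h + (z * C) * D (suc h)) ≈ (z * C) * D h
    split h = begin
      z * (D h + (z * C) * D (suc h))
        ≈⟨ *-congˡ {x = z} (+-congˡ (*-congˡ {x = z * C} (D-geometric h))) ⟩
      z * (D h + (z * C) * ((v * C) * D h))
        ≈⟨ solve 4 (λ z C v d → z :* (d :+ (z :* C) :* ((v :* C) :* d))
             := (z :* (con 1 :+ z :* (v :* C :* C))) :* d) refl z C v (D h) ⟩
      (z * (1# + z * (v * C * C))) * D h
        ≈⟨ *-congʳ {x = D h} (*-congˡ {x = z} (sym C-eq)) ⟩
      (z * C) * D h ∎
    step : ∀ n h → viaMax falling h n P.≈ (z * (D h + (z * C) * D (suc h))) n
    step zero    h = P.sym (X-*-zero (D h + (z * C) * D (suc h)))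
    step (suc n) h = P.trans (P.+-congˡ (viaMax-falling n (suc h)))
      (P.sym (X-*-suc (D h + (z * C) * D (suc h)) n))

  completions-initial : completions initial 0 ≈ 1# + (z * C) * C
  completions-initial = trans (completions-zero initial) (+-congˡ (λ n → viaMax-falling n 0))

-- Enumeration of 321-avoiding permutations

module Enumeration where

  open import Data.Bool using (Bool; true; false; _∧_; if_then_else_)
  open import Data.Bool.Properties using (∧-zeroʳ)
  open import Data.Fin as Fin using (Fin; toℕ; _↑ˡ_; _↑ʳ_)
  open import Data.Fin.Patterns using (0F; 1F; 2F)
  import Data.Fin.Properties as Fin
  open import Data.List using (List; _++_; filter; length; allFin; cartesianProductWith; tabulate)
  open import Data.List.Membership.Propositional using (_∈_)
  import Data.List.Membership.Propositional.Properties as ∈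
  import Data.List.Properties as List
  open import Data.List.Relation.Binary.Permutation.Propositional using (_↭_; ↭-sym; prep; ↭⇒↭ₛ)
  import Data.List.Relation.Binary.Permutation.Propositional.Properties as ↭
  import Data.List.Relation.Binary.Permutation.Setoid.Properties as ↭ₛ
  open import Data.List.Relation.Unary.All as All using (All; []; _∷_)
  import Data.List.Relation.Unary.All.Properties as All
  open import Data.List.Relation.Unary.AllPairs as AllPairs using (AllPairs; []; _∷_)
  import Data.List.Relation.Unary.AllPairs.Properties as AllPairs
  open import Data.List.Relation.Unary.Any using (here; there)
  open import Data.List.Relation.Unary.Unique.Propositional using (Unique)
  import Data.List.Relation.Unary.Unique.Propositional.Properties as Unique
  open import Data.Nat using (_+_; _<_; _<?_; _≟_; z<s)
  open import Data.Product using (proj₁; proj₂)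
  open import Data.Product.Function.NonDependent.Propositional using (_×-⇔_)
  open import Data.Sum using (inj₁; inj₂)
  open import Data.Unit using (⊤)
  open import Data.Vec using (Vec; []; _∷_; lookup)
  open import Function using (_∘_; _⇔_; mk⇔; id)
  open import Function.Bundles using (module Equivalence)
  open import Function.Construct.Composition using (_⇔-∘_)
  open import Function.Construct.Identity using (⇔-id)
  open import Relation.Binary.Definitions using (tri<; tri≈; tri>)
  open import Relation.Binary.PropositionalEquality
  open import Relation.Nullary using (¬_; yes; no; does; contradiction)
  open import Relation.Nullary.Decidable using (dec-true; dec-false)
  open import Relation.Unary using (Pred; Decidable)

  open Equivalence using (to; from)

  private
    variable
      p ρ : Level
      A B C : Set a
      m n : ℕ

  -- Counting with filters and finite sums

  length-filter-map : {P : Pred B p} (P? : Decidable P) (f : A → B) (xs : List A) →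
    length (filter P? (map f xs)) ≡ length (filter (P? ∘ f) xs)
  length-filter-map P? f []       = refl
  length-filter-map P? f (x ∷ xs) with P? (f x)
  ... | yes _ = cong suc (length-filter-map P? f xs)
  ... | no  _ = length-filter-map P? f xs

  length-filter-none : {P : Pred A p} (P? : Decidable P) → (∀ x → ¬ P x) →
    ∀ xs → length (filter P? xs) ≡ 0
  length-filter-none P? ¬P xs = cong length (List.filter-none P? (All.universal ¬P xs))

  ∑ : ∀ n → (Fin n → ℕ) → ℕ
  ∑ zero    g = 0
  ∑ (suc n) g = g Fin.zero + ∑ n (g ∘ Fin.suc)

  ∑-zero : ∀ n {g : Fin n → ℕ} → (∀ i → g i ≡ 0) → ∑ n g ≡ 0
  ∑-zero zero    g≡0 = refl
  ∑-zero (suc n) g≡0 = cong₂ _+_ (g≡0 Fin.zero) (∑-zero n (g≡0 ∘ Fin.suc))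

  ∑-single : ∀ {n} {g : Fin n → ℕ} (i : Fin n) → (∀ j → j ≢ i → g j ≡ 0) → ∑ n g ≡ g i
  ∑-single {suc n} {g} Fin.zero g≡0 =
    trans (cong (g Fin.zero +_) (∑-zero n (λ j → g≡0 (Fin.suc j) λ ()))) (ℕ.+-identityʳ _)
  ∑-single {suc n} (Fin.suc i) g≡0 =
    cong₂ _+_ (g≡0 Fin.zero λ ()) (∑-single i (λ j j≢i → g≡0 (Fin.suc j) (j≢i ∘ Fin.suc-injective)))

  ∑-+ : ∀ b r (g : Fin (b + r) → ℕ) → ∑ (b + r) g ≡ ∑ b (g ∘ (_↑ˡ r)) + ∑ r (g ∘ (b ↑ʳ_))
  ∑-+ zero    r g = refl
  ∑-+ (suc b) r g = trans (cong (g Fin.zero +_) (∑-+ b r (g ∘ Fin.suc))) (sym (ℕ.+-assoc (g Fin.zero) _ _))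

  -- Counts words by their first letter. The list `allFin n` is generalised to `tabulate g` so that
  -- the induction can shift indices.
  length-filter-product : {P : Pred C p} (P? : Decidable P) (f : A → B → C) (ys : List B)
    (g : Fin n → A) →
    length (filter P? (cartesianProductWith f (tabulate g) ys)) ≡
    ∑ n (λ i → length (filter (P? ∘ f (g i)) ys))
  length-filter-product {n = zero}  P? f ys g = refl
  length-filter-product {n = suc n} P? f ys g = begin
    length (filter P? (map f₀ ys ++ rest))                         ≡⟨ cong length (List.filter-++ P? (map f₀ ys) rest) ⟩
    length (filter P? (map f₀ ys) ++ filter P? rest)               ≡⟨ List.length-++ (filter P? (map f₀ ys)) ⟩
    length (filter P? (map f₀ ys)) + length (filter P? rest)
      ≡⟨ cong₂ _+_ (length-filter-map P? f₀ ys) (length-filter-product P? f ys (g ∘ Fin.suc)) ⟩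
    length (filter (P? ∘ f₀) ys) + ∑ n (λ i → length (filter (P? ∘ f (g (Fin.suc i))) ys)) ∎
    where
    open ≡-Reasoning
    f₀ = f (g Fin.zero)
    rest = cartesianProductWith f (tabulate (g ∘ Fin.suc)) ys

  -- Intervals of letters and completions of a prefix

  infix 6 _↑_

  _↑_ : ℕ → ℕ → List ℕ
  b ↑ zero  = []
  b ↑ suc r = b ∷ (suc b ↑ r)

  length-↑ : ∀ b r → length (b ↑ r) ≡ r
  length-↑ b zero    = refl
  length-↑ b (suc r) = cong suc (length-↑ (suc b) r)

  ↑-+ : ∀ b j r → b ↑ (j + r) ≡ (b ↑ j) ++ ((b + j) ↑ r)
  ↑-+ b zero    r = cong (_↑ r) (sym (ℕ.+-identityʳ b))
  ↑-+ b (suc j) r = cong (b ∷_) (trans (↑-+ (suc b) j r)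
    (cong (λ x → (suc b ↑ j) ++ (x ↑ r)) (sym (ℕ.+-suc b j))))

  All≤-↑ : ∀ b r → All (b ≤_) (b ↑ r)
  All≤-↑ b zero    = []
  All≤-↑ b (suc r) = ℕ.≤-refl ∷ All.map ℕ.<⇒≤ (All≤-↑ (suc b) r)

  All<-↑ : ∀ b r → All (_< b + r) (b ↑ r)
  All<-↑ b zero    = []
  All<-↑ b (suc r) = ℕ.m<m+n b z<s ∷ subst (λ x → All (_< x) (suc b ↑ r)) (sym (ℕ.+-suc b r)) (All<-↑ (suc b) r)

  sorted-↑ : ∀ b r → AllPairs _<_ (b ↑ r)
  sorted-↑ b zero    = []
  sorted-↑ b (suc r) = All≤-↑ (suc b) r ∷ sorted-↑ (suc b) r

  -- Once `c` has been read, a descent among later letters below `c` would complete a 321. Of all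
  -- letters read, the largest gives the strongest condition, so a prefix is represented by its
  -- maximum.
  NoDescentBelow : ℕ → List ℕ → Set
  NoDescentBelow c = AllPairs (λ x y → x < c → x ≤ y)

  Avoids321 : List ℕ → Set
  Avoids321 []      = ⊤
  Avoids321 (x ∷ w) = NoDescentBelow x w × Avoids321 w

  -- The words w which can follow a prefix with maximum c when L lists the unused
  -- letters below b and all of the r letters from b on are unused.
  record Completes (c b : ℕ) (L : List ℕ) (r : ℕ) (w : List ℕ) : Set where
    constructor completes
    field
      letters↭  : w ↭ L ++ (b ↑ r)
      noDescent : NoDescentBelow c w
      avoids321 : Avoids321 w

  bump : Phase → ℕ → ℕ
  bump initial n = n
  bump falling n = n
  bump rising  n = suc n

  -- Here `b` stands for the successor of the maximum read so far, or 0 at the start. Only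
  -- comparisons with `b` are made, in step with `viaMin` and `viaMax`.
  peaks : Phase → ℕ → List ℕ → ℕ
  peaks φ b []      = 0
  peaks φ b (x ∷ w) with x <? b
  ... | yes _ = bump φ (peaks falling b w)
  ... | no  _ = peaks (afterMax φ) (suc x) w

  peaks-min : ∀ φ {b x} w → x < b → peaks φ b (x ∷ w) ≡ bump φ (peaks falling b w)
  peaks-min φ {b} {x} w x<b with x <? b
  ... | yes _   = refl
  ... | no  x≮b = contradiction x<b x≮b

  peaks-max : ∀ φ {b x} w → b ≤ x → peaks φ b (x ∷ w) ≡ peaks (afterMax φ) (suc x) w
  peaks-max φ {b} {x} w b≤x with x <? b
  ... | yes x<b = contradiction x<b (ℕ.≤⇒≯ b≤x)
  ... | no  _   = refl

  NoDescentBelow-mono : ∀ {c d w} → c ≤ d → NoDescentBelow d w → NoDescentBelow c w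
  NoDescentBelow-mono c≤d = AllPairs.map (λ below x<c → below (ℕ.<-≤-trans x<c c≤d))

  -- The new maximum is not below `c`, so `c` does not restrict it, and the condition it imposes on
  -- `w` implies that of `c`. The `j` skipped letters join `L`.
  completes-max : ∀ {c b L} j r {w} → c ≤ b →
    Completes c b L (j + suc r) (b + j ∷ w) ⇔
    Completes (b + j) (suc (b + j)) (L ++ (b ↑ j)) r w
  completes-max {c} {b} {L} j r {w} c≤b = mk⇔
    (λ (completes perm _ (inc , av)) →
      completes (↭.drop-mid [] (L ++ (b ↑ j)) (subst (b + j ∷ w ↭_) split perm)) inc av)
    (λ (completes perm inc av) →
      completes
        (subst (b + j ∷ w ↭_) (sym split)
          (_↭_.trans (prep (b + j) perm) (↭-sym (↭.shift (b + j) (L ++ (b ↑ j)) _))))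
        (All.universal (λ _ x<c → contradiction x<c (ℕ.≤⇒≯ c≤x)) w ∷ NoDescentBelow-mono c≤x inc)
        (inc , av))
    where
    c≤x : c ≤ b + j
    c≤x = ℕ.≤-trans c≤b (ℕ.m≤m+n b j)
    split : L ++ (b ↑ (j + suc r)) ≡ (L ++ (b ↑ j)) ++ (b + j ∷ (suc (b + j) ↑ r))
    split = trans (cong (L ++_) (↑-+ b j (suc r))) (sym (List.++-assoc L (b ↑ j) _))

  completes-min : ∀ {c b l L r w} → c ≤ b → l < c → All (l <_) L →
    Completes c b (l ∷ L) r (l ∷ w) ⇔ Completes c b L r w
  completes-min {c} {b} {l} {L} {r} {w} c≤b l<c l<L = mk⇔
    (λ { (completes perm (_ ∷ inc) (_ , av)) → completes (↭.drop-∷ perm) inc av })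
    (λ (completes perm inc av) →
      completes (prep l perm)
        (All.map (λ l≤y _ → l≤y)
          (↭.All-resp-↭ (↭-sym perm)
            (All.++⁺ (All.map ℕ.<⇒≤ l<L)
              (All.map (ℕ.≤-trans (ℕ.<⇒≤ (ℕ.<-≤-trans l<c c≤b))) (All≤-↑ b r)))) ∷ inc)
        (NoDescentBelow-mono (ℕ.<⇒≤ l<c) inc , av))

  completes-⇒∈ : ∀ {c b L r x w} → x < b → Completes c b L r (x ∷ w) → x ∈ L
  completes-⇒∈ {b = b} {L} {r} x<b (completes perm _ _)
    with ∈.∈-++⁻ L (↭.∈-resp-↭ perm (here refl))
  ... | inj₁ x∈L = x∈L
  ... | inj₂ x∈↑ = contradiction x<b (ℕ.≤⇒≯ (All.lookup (All≤-↑ b r) x∈↑))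

  -- If another letter of `L` came first, `l` would follow it later and make a descent below `c`.
  completes-⇒least : ∀ {c b l L r x w} → c ≤ b → AllPairs _<_ (l ∷ L) → All (_< c) (l ∷ L) →
    x < b → Completes c b (l ∷ L) r (x ∷ w) → x ≡ l
  completes-⇒least c≤b (l<L ∷ _) L<c x<b good@(completes perm (inc ∷ _) _)
    with completes-⇒∈ x<b good | ↭.∈-resp-↭ (↭-sym perm) (here refl)
  ... | here x≡l  | _         = x≡l
  ... | there _   | here l≡x  = sym l≡x
  ... | there x∈L | there l∈w = contradiction
    (All.lookup inc l∈w (All.lookup L<c (there x∈L))) (ℕ.<⇒≱ (All.lookup l<L x∈L))

  -- Counting the completions

  letters : Vec (Fin n) m → List ℕ
  letters []      = []
  letters (x ∷ w) = toℕ x ∷ letters w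

  -- Multiplication by `q` on sequences indexed by the number of peaks. Over such sequences
  -- `Completions` yields the counts themselves.
  shift : (ℕ → ℕ) → ℕ → ℕ
  shift f zero    = 0
  shift f (suc k) = f k

  #zero #one : ℕ → ℕ
  #zero k      = 0
  #one zero    = 1
  #one (suc k) = 0

  _#+_ : (ℕ → ℕ) → (ℕ → ℕ) → ℕ → ℕ
  (f #+ g) k = f k + g k

  open Completions #zero #one _#+_ shift
    using () renaming (weigh to #weigh; completions to #completions; viaMin to #viaMin; viaMax to #viaMax) public

  ∑-viaMax : ∀ φ h r k (g : Fin r → ℕ) →
    (∀ j r′ → r ≡ toℕ j + suc r′ → g j ≡ #completions φ (h + toℕ j) r′ k) →
    ∑ r g ≡ #viaMax φ h r k
  ∑-viaMax φ h zero    k g g≡ = refl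
  ∑-viaMax φ h (suc r) k g g≡ = cong₂ _+_
    (trans (g≡ Fin.zero r refl) (cong (λ h → #completions φ h r k) (ℕ.+-identityʳ h)))
    (∑-viaMax φ (suc h) r k (g ∘ Fin.suc) (λ j r′ r≡ →
      trans (g≡ (Fin.suc j) r′ (cong suc r≡)) (cong (λ h → #completions φ h r′ k) (ℕ.+-suc h (toℕ j)))))

  -- In the recursion `b` is `suc c`, except at the start, where both are 0 and `c` restricts
  -- nothing; `c ≤ b` covers both cases.
  record Unused (c b : ℕ) (L : List ℕ) : Set where
    constructor unused
    field
      c≤b    : c ≤ b
      sorted : AllPairs _<_ L
      L<c    : All (_< c) L

  unused-max : ∀ {c b L} j → Unused c b L → Unused (b + j) (suc (b + j)) (L ++ (b ↑ j))
  unused-max {c} {b} {L} j (unused c≤b sorted L<c) = unused (ℕ.n≤1+n _)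
    (AllPairs.++⁺ sorted (sorted-↑ b j)
      (All.map (λ x<c → All.map (ℕ.<-≤-trans (ℕ.<-≤-trans x<c c≤b)) (All≤-↑ b j)) L<c))
    (All.++⁺ (All.map (λ x<c → ℕ.<-≤-trans x<c (ℕ.≤-trans c≤b (ℕ.m≤m+n b j))) L<c) (All<-↑ b j))

  CompletesWith : Phase → (c b : ℕ) → List ℕ → ℕ → ℕ → List ℕ → Set
  CompletesWith φ c b L r k w = Completes c b L r w × peaks φ b w ≡ k

  ≡⇒⇔ : {x y z : A} → x ≡ y → x ≡ z ⇔ y ≡ z
  ≡⇒⇔ refl = ⇔-id _

  completesWith-max : ∀ φ {c b L r k x w} j r′ → c ≤ b → r ≡ j + suc r′ → x ≡ b + j →
    CompletesWith φ c b L r k (x ∷ w) ⇔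
    CompletesWith (afterMax φ) (b + j) (suc (b + j)) (L ++ (b ↑ j)) r′ k w
  completesWith-max φ {b = b} {w = w} j r′ c≤b refl refl =
    completes-max j r′ c≤b ×-⇔ ≡⇒⇔ (peaks-max φ w (ℕ.m≤m+n b j))

  completesWith-min : ∀ φ {c b l L r k x w} → Unused c b (l ∷ L) → x ≡ l →
    CompletesWith φ c b (l ∷ L) r k (x ∷ w) ⇔
    (Completes c b L r w × bump φ (peaks falling b w) ≡ k)
  completesWith-min φ {w = w} (unused c≤b (l<L ∷ _) (l<c ∷ _)) refl =
    completes-min c≤b l<c l<L ×-⇔ ≡⇒⇔ (peaks-min φ w (ℕ.<-≤-trans l<c c≤b))

  length-completions : ∀ m φ {c b L r n} k → Unused c b L → n ≡ b + r → length L + r ≡ m →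
    {P : Pred (Word n m) p} (P? : Decidable P) →
    (∀ w → P w ⇔ CompletesWith φ c b L r k (letters w)) →
    length (filter P? (words n m)) ≡ #completions φ (length L) r k
  length-completions zero φ {L = []} {r = zero} k _ _ _ P? P⇔ with P? [] | k
  ... | yes _  | zero  = refl
  ... | yes p  | suc _ = contradiction (proj₂ (to (P⇔ []) p)) λ ()
  ... | no  ¬p | zero  = contradiction (from (P⇔ []) (completes _↭_.refl [] _ , refl)) ¬p
  ... | no  _  | suc _ = refl
  length-completions (suc m) φ {c} {b} {L} {r} k u@(unused c≤b _ _) refl |L|+r≡1+m {P} P? P⇔ =
    trans (length-filter-product P? _∷_ (words (b + r) m) (λ i → i))
      (trans (∑-+ b r N)
        (cong₂ _+_ (min L u |L|+r≡1+m P⇔) (∑-viaMax (afterMax φ) (length L) r k _ max)))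
    where
    N : Fin (b + r) → ℕ
    N x = length (filter (P? ∘ (x ∷_)) (words (b + r) m))

    max : ∀ j r′ → r ≡ toℕ j + suc r′ →
      N (b ↑ʳ j) ≡ #completions (afterMax φ) (length L + toℕ j) r′ k
    max j r′ r≡ = trans
      (length-completions m (afterMax φ) k (unused-max (toℕ j) u)
        (trans (cong (b +_) r≡)
          (trans (sym (ℕ.+-assoc b (toℕ j) (suc r′))) (ℕ.+-suc (b + toℕ j) r′)))
        (ℕ.suc-injective
          (trans (cong (λ l → suc (l + r′)) length≡)
            (trans (trans (sym (ℕ.+-suc (length L + toℕ j) r′)) (ℕ.+-assoc (length L) (toℕ j) (suc r′)))
              (trans (cong (length L +_) (sym r≡)) |L|+r≡1+m))))
        (P? ∘ ((b ↑ʳ j) ∷_))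
        (λ w → completesWith-max φ (toℕ j) r′ c≤b r≡ (Fin.toℕ-↑ʳ b j) ⇔-∘ P⇔ ((b ↑ʳ j) ∷ w)))
      (cong (λ h → #completions (afterMax φ) h r′ k) length≡)
      where
      length≡ : length (L ++ (b ↑ toℕ j)) ≡ length L + toℕ j
      length≡ = trans (List.length-++ L) (cong (length L +_) (length-↑ b (toℕ j)))

    min : ∀ L → Unused c b L → length L + r ≡ suc m →
      (∀ w → P w ⇔ CompletesWith φ c b L r k (letters w)) →
      ∑ b (N ∘ (_↑ˡ r)) ≡ #viaMin φ (length L) r k
    min [] _ refl P⇔ = ∑-zero b λ i → length-filter-none (P? ∘ ((i ↑ˡ r) ∷_))
      (λ w p → contradiction (completes-⇒∈ (toℕ<b i) (proj₁ (to (P⇔ ((i ↑ˡ r) ∷ w)) p))) λ ())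
      (words (b + r) m)
      where
      toℕ<b : ∀ i → toℕ (i ↑ˡ r) < b
      toℕ<b i = subst (_< b) (sym (Fin.toℕ-↑ˡ i r)) (Fin.toℕ<n i)
    min (l ∷ L′) u′@(unused _ sorted@(_ ∷ sorted′) L<c@(l<c ∷ L′<c)) |L|+r≡1+m P⇔ =
      trans (∑-single i₀ others) (single φ k (λ w → completesWith-min φ u′ x₀≡l ⇔-∘ P⇔ (x₀ ∷ w)))
      where
      l<b = ℕ.<-≤-trans l<c c≤b
      i₀ = Fin.fromℕ< l<b
      x₀ = i₀ ↑ˡ r
      x₀≡l : toℕ x₀ ≡ l
      x₀≡l = trans (Fin.toℕ-↑ˡ i₀ r) (Fin.toℕ-fromℕ< l<b)
      others : ∀ i → i ≢ i₀ → N (i ↑ˡ r) ≡ 0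
      others i i≢i₀ = length-filter-none (P? ∘ ((i ↑ˡ r) ∷_))
        (λ w p → i≢i₀ (Fin.toℕ-injective
          (trans (trans (sym (Fin.toℕ-↑ˡ i r))
            (completes-⇒least c≤b sorted L<c
              (subst (_< b) (sym (Fin.toℕ-↑ˡ i r)) (Fin.toℕ<n i))
              (proj₁ (to (P⇔ ((i ↑ˡ r) ∷ w)) p))))
            (sym (Fin.toℕ-fromℕ< l<b)))))
        (words (b + r) m)
      rec : ∀ k → (∀ w → P (x₀ ∷ w) ⇔ CompletesWith falling c b L′ r k (letters w)) →
        N x₀ ≡ #completions falling (length L′) r k
      rec k = length-completions m falling k (unused c≤b sorted′ L′<c) refl
        (ℕ.suc-injective |L|+r≡1+m) (P? ∘ (x₀ ∷_))
      single : ∀ φ k →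
        (∀ w → P (x₀ ∷ w) ⇔
          (Completes c b L′ r (letters w) × bump φ (peaks falling b (letters w)) ≡ k)) →
        N x₀ ≡ #weigh φ (#completions falling (length L′) r) k
      single initial k       P⇔ = rec k P⇔
      single falling k       P⇔ = rec k P⇔
      -- In phase `rising` the smaller letter completes a peak: zero peaks are impossible, and
      -- otherwise one fewer remains, as in `shift`.
      single rising  zero    P⇔ = length-filter-none (P? ∘ (x₀ ∷_))
        (λ w p → contradiction (proj₂ (to (P⇔ w) p)) λ ()) (words (b + r) m)
      single rising  (suc k) P⇔ = rec k λ w →
        (⇔-id _ ×-⇔ mk⇔ ℕ.suc-injective (cong suc)) ⇔-∘ P⇔ w

  -- Permutations as rearrangements of an interval

  letters≡tabulate : (w : Vec (Fin n) m) → letters w ≡ tabulate (toℕ ∘ lookup w)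
  letters≡tabulate []      = refl
  letters≡tabulate (x ∷ w) = cong (toℕ x ∷_) (letters≡tabulate w)

  length-letters : (w : Vec (Fin n) m) → length (letters w) ≡ m
  length-letters []      = refl
  length-letters (x ∷ w) = cong suc (length-letters w)

  AllPairs-tabulate⁻ : {R : A → A → Set ρ} {f : Fin n → A} → AllPairs R (tabulate f) →
    ∀ {i j} → i Fin.< j → R (f i) (f j)
  AllPairs-tabulate⁻ {n = suc n} (Rx ∷ _)  {Fin.zero}  {Fin.suc j} _         = All.tabulate⁻ Rx j
  AllPairs-tabulate⁻ {n = suc n} (_ ∷ Rxs) {Fin.suc i} {Fin.suc j} (s≤s i<j) = AllPairs-tabulate⁻ Rxs i<j

  -- A pigeonhole argument: removing each entry of `xs` from `ys` keeps the lengths equal, so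
  -- nothing is left over.
  unique∧⊆⇒↭ : {xs ys : List A} → Unique xs → All (_∈ ys) xs → length xs ≡ length ys → xs ↭ ys
  unique∧⊆⇒↭ {xs = []}     {ys = []} _ _ _ = _↭_.refl
  unique∧⊆⇒↭ {xs = x ∷ xs} (x∉xs ∷ unique) (x∈ys ∷ xs⊆ys) len with ∈.∈-∃++ x∈ys
  ... | us , vs , refl = _↭_.trans
    (prep x (unique∧⊆⇒↭ unique (All.zipWith drop-x (x∉xs , xs⊆ys))
      (ℕ.suc-injective (trans len (↭.↭-length (↭.shift x us vs))))))
    (↭-sym (↭.shift x us vs))
    where
    drop-x : ∀ {y} → x ≢ y × y ∈ us ++ x ∷ vs → y ∈ us ++ vs
    drop-x (x≢y , y∈) with ∈.∈-++⁻ us y∈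
    ... | inj₁ y∈us         = ∈.∈-++⁺ˡ y∈us
    ... | inj₂ (here y≡x)   = contradiction (sym y≡x) x≢y
    ... | inj₂ (there y∈vs) = ∈.∈-++⁺ʳ us y∈vs

  ∈-↑ : ∀ b {r x} → b ≤ x → x < b + r → x ∈ b ↑ r
  ∈-↑ b {zero}  {x} b≤x x<b+r = contradiction (subst (x <_) (ℕ.+-identityʳ b) x<b+r) (ℕ.≤⇒≯ b≤x)
  ∈-↑ b {suc r} {x} b≤x x<b+r with b ≟ x
  ... | yes refl = here refl
  ... | no  b≢x  = there (∈-↑ (suc b) (ℕ.≤∧≢⇒< b≤x b≢x) (subst (x <_) (ℕ.+-suc b r) x<b+r))

  unique-letters : {π : Word n n} → letters π ↭ 0 ↑ n → Unique (letters π)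
  unique-letters {n} perm = ↭ₛ.Unique-resp-↭ (setoid ℕ) (↭⇒↭ₛ (↭-sym perm))
    (AllPairs.map ℕ.<⇒≢ (sorted-↑ 0 n))

  isPermutation⇔↭ : (π : Word n n) → IsPermutation π ⇔ (letters π ↭ 0 ↑ n)
  isPermutation⇔↭ {n} π = mk⇔ perm (λ perm → injective perm , surjective perm)
    where
    perm : IsPermutation π → letters π ↭ 0 ↑ n
    perm (injective , _) = unique∧⊆⇒↭
      (subst Unique (sym (letters≡tabulate π))
        (Unique.tabulate⁺ (λ {i} {j} eq → injective {i} {j} (Fin.toℕ-injective eq))))
      (subst (All (_∈ 0 ↑ n)) (sym (letters≡tabulate π))
        (All.tabulate⁺ λ i → ∈-↑ 0 z≤n (Fin.toℕ<n (lookup π i))))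
      (trans (length-letters π) (sym (length-↑ 0 n)))
    injective : letters π ↭ 0 ↑ n → ∀ {i j} → lookup π i ≡ lookup π j → i ≡ j
    injective perm {i} {j} eq with Fin.<-cmp i j
    ... | tri< i<j _ _ = contradiction (cong toℕ eq) (distinct i<j)
      where distinct = AllPairs-tabulate⁻ (subst Unique (letters≡tabulate π) (unique-letters perm))
    ... | tri≈ _ i≡j _ = i≡j
    ... | tri> _ _ j<i = contradiction (cong toℕ (sym eq)) (distinct j<i)
      where distinct = AllPairs-tabulate⁻ (subst Unique (letters≡tabulate π) (unique-letters perm))
    surjective : letters π ↭ 0 ↑ n → ∀ y → _
    surjective perm y with ∈.∈-tabulate⁻
      (subst (toℕ y ∈_) (letters≡tabulate π) (↭.∈-resp-↭ (↭-sym perm) (∈-↑ 0 z≤n (Fin.toℕ<n y))))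
    ... | i , y≡πi = i , λ { refl → sym (Fin.toℕ-injective y≡πi) }

  -- Avoidance of 321 on lists of letters

  avoids321-tabulate⁺ : ∀ {n} {f : Fin n → ℕ} →
    (∀ {i j k} → i Fin.< j → j Fin.< k → f j < f i → f j ≤ f k) → Avoids321 (tabulate f)
  avoids321-tabulate⁺ {zero}  avoids = _
  avoids321-tabulate⁺ {suc n} avoids =
    AllPairs.tabulate⁺-< (λ j<k → avoids {Fin.zero} (s≤s z≤n) (s≤s j<k)) ,
    avoids321-tabulate⁺ (λ i<j j<k → avoids (s≤s i<j) (s≤s j<k))

  avoids321-tabulate⁻ : ∀ {n} {f : Fin n → ℕ} → Avoids321 (tabulate f) →
    ∀ {i j k} → i Fin.< j → j Fin.< k → f j < f i → f j ≤ f k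
  avoids321-tabulate⁻ {suc n} (below , _) {Fin.zero} {Fin.suc j} {Fin.suc k} _ (s≤s j<k) =
    AllPairs-tabulate⁻ below j<k
  avoids321-tabulate⁻ {suc n} (_ , avoids) {Fin.suc i} {Fin.suc j} {Fin.suc k} (s≤s i<j) (s≤s j<k) =
    avoids321-tabulate⁻ avoids i<j j<k

  occurrence321 : (π : Word n n) → ∀ {i j k} → i Fin.< j → j Fin.< k →
    lookup π j Fin.< lookup π i → lookup π k Fin.< lookup π j →
    IsOccurrence [321] π (i ∷ j ∷ k ∷ [])
  occurrence321 π {i} {j} {k} i<j j<k πj<πi πk<πj = increasing , λ a b → mk⇔ (⇒ a b) (⇐ a b)
    where
    is = i ∷ j ∷ k ∷ []
    πk<πi = ℕ.<-trans πk<πj πj<πi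
    increasing : ∀ a b → a Fin.< b → lookup is a Fin.< lookup is b
    increasing 0F 1F _ = i<j
    increasing 0F 2F _ = ℕ.<-trans i<j j<k
    increasing 1F 2F _ = j<k
    increasing 1F 1F (s≤s ())
    increasing 2F 1F (s≤s ())
    increasing 2F 2F (s≤s (s≤s ()))
    ⇐ : ∀ a b → lookup [321] a Fin.< lookup [321] b → lookup π (lookup is a) Fin.< lookup π (lookup is b)
    ⇐ 1F 0F _ = πj<πi
    ⇐ 2F 0F _ = πk<πi
    ⇐ 2F 1F _ = πk<πj
    ⇐ 0F 0F (s≤s (s≤s ()))
    ⇐ 0F 1F (s≤s ())
    ⇐ 1F 1F (s≤s ())
    ⇐ _  2F ()
    ⇒ : ∀ a b → lookup π (lookup is a) Fin.< lookup π (lookup is b) → lookup [321] a Fin.< lookup [321] b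
    ⇒ 1F 0F _ = s≤s (s≤s z≤n)
    ⇒ 2F 0F _ = s≤s z≤n
    ⇒ 2F 1F _ = s≤s z≤n
    ⇒ 0F 0F x<x = contradiction x<x (ℕ.<-irrefl refl)
    ⇒ 1F 1F x<x = contradiction x<x (ℕ.<-irrefl refl)
    ⇒ 2F 2F x<x = contradiction x<x (ℕ.<-irrefl refl)
    ⇒ 0F 1F πi<πj = contradiction πi<πj (ℕ.<-asym πj<πi)
    ⇒ 0F 2F πi<πk = contradiction πi<πk (ℕ.<-asym πk<πi)
    ⇒ 1F 2F πj<πk = contradiction πj<πk (ℕ.<-asym πk<πj)

  avoids⇔avoids321 : (π : Word n n) → π Avoids [321] ⇔ Avoids321 (letters π)
  avoids⇔avoids321 π = mk⇔ avoids⇒ ⇒avoids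
    where
    avoids⇒ : π Avoids [321] → Avoids321 (letters π)
    avoids⇒ avoids = subst Avoids321 (sym (letters≡tabulate π)) (avoids321-tabulate⁺
      λ {i} {j} {k} i<j j<k πj<πi → ℕ.≮⇒≥ λ πk<πj →
        avoids (i ∷ j ∷ k ∷ [] , occurrence321 π i<j j<k πj<πi πk<πj))
    ⇒avoids : Avoids321 (letters π) → π Avoids [321]
    ⇒avoids avoids (is , increasing , pattern⇔) = ℕ.<⇒≱
      (from (pattern⇔ 2F 1F) (s≤s z≤n))
      (avoids321-tabulate⁻ (subst Avoids321 (letters≡tabulate π) avoids)
        (increasing 0F 1F (s≤s z≤n)) (increasing 1F 2F (s≤s (s≤s z≤n)))
        (from (pattern⇔ 1F 0F) (s≤s (s≤s z≤n))))

  -- Peaks of a 321-avoiding permutation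

  suc-if : Bool → ℕ → ℕ
  suc-if c n = if c then suc n else n

  -- The number of peaks of p ∷ x ∷ w strictly after p, where ascent says if p < x.
  peaksAfter : Bool → ℕ → List ℕ → ℕ
  peaksAfter ascent x []      = 0
  peaksAfter ascent x (y ∷ w) =
    suc-if (ascent ∧ does (y <? x)) (peaksAfter (does (x <? y)) y w)

  length-filter-∷ : {P : Pred A p} (P? : Decidable P) (x : A) (xs : List A) →
    length (filter P? (x ∷ xs)) ≡ suc-if (does (P? x)) (length (filter P? xs))
  length-filter-∷ P? x xs with does (P? x)
  ... | true  = refl
  ... | false = refl

  pk-∷ : (x y z : Fin n) (w : Vec (Fin n) m) →
    pk (x ∷ y ∷ z ∷ w) ≡ suc-if (does (x Fin.<? y) ∧ does (z Fin.<? y)) (pk (y ∷ z ∷ w))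
  pk-∷ {m = m} x y z w = trans (length-filter-∷ (isPeak? (x ∷ y ∷ z ∷ w)) Fin.zero (tabulate Fin.suc))
    (cong (suc-if _) (trans
      (cong (length ∘ filter (isPeak? (x ∷ y ∷ z ∷ w))) (sym (List.map-tabulate id Fin.suc)))
      -- Composed with `Fin.suc`, the peak test of the longer word is definitionally that of
      -- `y ∷ z ∷ w`.
      (length-filter-map (isPeak? (x ∷ y ∷ z ∷ w)) Fin.suc (allFin m))))

  pk≡peaksAfter : (x y : Fin n) (w : Vec (Fin n) m) →
    pk (x ∷ y ∷ w) ≡ peaksAfter (does (x Fin.<? y)) (toℕ y) (letters w)
  pk≡peaksAfter x y []      = refl
  pk≡peaksAfter x y (z ∷ w) = trans (pk-∷ x y z w) (cong (suc-if _) (pk≡peaksAfter y z w))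

  mutual

    -- Here the last letter is the maximum `c`, reached by an ascent, so the next letter decides
    -- whether it is a peak. Distinctness excludes equality.
    peaksAfter-rising : ∀ c w → NoDescentBelow c w → Avoids321 w → Unique (c ∷ w) →
      peaksAfter true c w ≡ peaks rising (suc c) w
    peaksAfter-rising c [] _ _ _ = refl
    peaksAfter-rising c (y ∷ w) (below ∷ noDescent) (noDescent-y , avoids) ((c≢y ∷ c∉w) ∷ y∉w ∷ unique)
      with ℕ.<-cmp c y
    ... | tri≈ _ c≡y _ = contradiction c≡y c≢y
    ... | tri< c<y _ y≮c
      rewrite dec-false (y <? c) y≮c | dec-true (c <? y) c<y =
      trans (peaksAfter-rising y w noDescent-y avoids (y∉w ∷ unique)) (sym (peaks-max rising w c<y))
    ... | tri> c≮y _ y<c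
      rewrite dec-true (y <? c) y<c | dec-false (c <? y) c≮y =
      trans
        (cong suc (peaksAfter-falling false c y w (ℕ.<⇒≤ y<c) (λ ()) noDescent avoids (c∉w ∷ unique)))
        (sym (peaks-min rising w (ℕ.m<n⇒m<1+n y<c)))

    -- After a letter below the maximum no descent, and hence no peak, can occur
    -- before the next new maximum.
    peaksAfter-falling : ∀ ascent c x w → x ≤ c →
      (ascent ≡ true → All (λ y → y < c → x ≤ y) w) →
      NoDescentBelow c w → Avoids321 w → Unique (c ∷ w) →
      peaksAfter ascent x w ≡ peaks falling (suc c) w
    peaksAfter-falling ascent c x [] _ _ _ _ _ = refl
    peaksAfter-falling ascent c x (y ∷ w) x≤c x≤ (below ∷ noDescent) (noDescent-y , avoids)
      ((c≢y ∷ c∉w) ∷ y∉w ∷ unique) with ℕ.<-cmp c y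
    ... | tri≈ _ c≡y _ = contradiction c≡y c≢y
    ... | tri< c<y _ _
      rewrite dec-false (y <? x) (ℕ.<⇒≯ (ℕ.≤-<-trans x≤c c<y)) | dec-true (x <? y) (ℕ.≤-<-trans x≤c c<y)
      | ∧-zeroʳ ascent =
      trans (peaksAfter-rising y w noDescent-y avoids (y∉w ∷ unique)) (sym (peaks-max falling w c<y))
    ... | tri> _ _ y<c = trans (noPeak ascent x≤)
      (trans
        -- As `y` lies below `c`, `below` says that no later letter is smaller than `y`, so `y`
        -- cannot become a peak.
        (peaksAfter-falling (does (x <? y)) c y w (ℕ.<⇒≤ y<c) (λ _ → All.map (λ y≤ _ → y≤ y<c) below)
          noDescent avoids (c∉w ∷ unique))
        (sym (peaks-min falling w (ℕ.m<n⇒m<1+n y<c))))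
      where
      noPeak : ∀ ascent → (ascent ≡ true → All (λ y → y < c → x ≤ y) (y ∷ w)) →
        ∀ {p} → suc-if (ascent ∧ does (y <? x)) p ≡ p
      noPeak false x≤ = refl
      noPeak true  x≤ rewrite dec-false (y <? x) (ℕ.≤⇒≯ (All.head (x≤ refl) y<c)) = refl

  pk≡peaks : (w : Vec (Fin n) m) → Avoids321 (letters w) → Unique (letters w) →
    pk w ≡ peaks initial 0 (letters w)
  pk≡peaks []          _                    _      = refl
  pk≡peaks (x ∷ [])    _                    _      = refl
  pk≡peaks (x ∷ y ∷ w) (noDescent , avoids) unique = trans (pk≡peaksAfter x y w)
    -- No ascent leads to the first letter, hence the flag `false`; that letter is also the current
    -- maximum.
    (peaksAfter-falling false (toℕ x) (toℕ x) (letters (y ∷ w)) ℕ.≤-refl (λ ()) noDescent avoids unique)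

  noDescentBelow-0 : ∀ w → NoDescentBelow 0 w
  noDescentBelow-0 []      = []
  noDescentBelow-0 (x ∷ w) = All.universal (λ _ ()) w ∷ noDescentBelow-0 w

  counted⇔completesWith : ∀ k (π : Word n n) →
    (IsPermutation π × π Avoids [321] × pk π ≡ k) ⇔ CompletesWith initial 0 0 [] n k (letters π)
  counted⇔completesWith k π = mk⇔
    (λ (permutation , avoids , pk≡k) →
      let perm = to (isPermutation⇔↭ π) permutation
          av   = to (avoids⇔avoids321 π) avoids
      in completes perm (noDescentBelow-0 (letters π)) av ,
         trans (sym (pk≡peaks π av (unique-letters perm))) pk≡k)
    (λ (completes perm _ av , peaks≡k) →
      from (isPermutation⇔↭ π) perm ,
      from (avoids⇔avoids321 π) av ,
      trans (pk≡peaks π av (unique-letters perm)) peaks≡k)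

  a^pk≡#completions : ∀ n k → a^pk [321] n k ≡ #completions initial 0 n k
  a^pk≡#completions n k =
    length-completions n initial k (unused z≤n [] []) refl refl _ (counted⇔completesWith k)

-- Transfer to rational coefficients and the closed form

open import Data.Integer using (+_)
import Data.Integer as ℤ
import Data.Integer.Properties as ℤ
open import Data.Rational using (_/_; 1ℚ; toℚᵘ)
import Data.Rational as ℚ
import Data.Rational.Properties as ℚ
open import Data.Rational.Unnormalised using (mkℚᵘ; *≡*)
import Data.Rational.Unnormalised as ℚᵘ
import Data.Rational.Unnormalised.Properties as ℚᵘ
open import Relation.Binary.PropositionalEquality using (_≡_; refl; sym; trans; cong; cong₂; module ≡-Reasoning)
open Enumeration using (#weigh; #completions; #viaMin; #viaMax; a^pk≡#completions)
open ℚ[q]⟦z⟧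

-- Addition in `ℚ` normalises fractions and does not reduce on variables, so the identity is checked
-- on unnormalised fractions with denominator 1.
+/1-homo-+ : ∀ m n → (+ (m ℕ.+ n)) / 1 ≡ (+ m) / 1 ℚ.+ (+ n) / 1
+/1-homo-+ m n = ℚ.toℚᵘ-injective (begin
  toℚᵘ ((+ (m ℕ.+ n)) / 1)                ≈⟨ ℚ.toℚᵘ-fromℚᵘ (mkℚᵘ (+ (m ℕ.+ n)) 0) ⟩
  mkℚᵘ (+ (m ℕ.+ n)) 0
    ≈⟨ *≡* (cong (ℤ._* + 1) (cong₂ ℤ._+_ (sym (ℤ.*-identityʳ (+ m))) (sym (ℤ.*-identityʳ (+ n))))) ⟩
  mkℚᵘ (+ m) 0 ℚᵘ.+ mkℚᵘ (+ n) 0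
    ≈⟨ ℚᵘ.+-cong (ℚ.toℚᵘ-fromℚᵘ (mkℚᵘ (+ m) 0)) (ℚ.toℚᵘ-fromℚᵘ (mkℚᵘ (+ n) 0)) ⟨
  toℚᵘ ((+ m) / 1) ℚᵘ.+ toℚᵘ ((+ n) / 1)  ≈⟨ ℚ.toℚᵘ-homo-+ ((+ m) / 1) ((+ n) / 1) ⟨
  toℚᵘ ((+ m) / 1 ℚ.+ (+ n) / 1)          ∎)
  where open ℚᵘ.≃-Reasoning

private
  module Coefficients = PolynomialRing ℚ.+-*-commutativeRing

open PowerSeriesRing Coefficients.commutativeRing using () renaming (commutativeRing to seriesRing)
open CompletionSeries Coefficients.commutativeRing ℚ[q].X
open Completions {A = ℚ[q].Poly} [] (1ℚ ∷ []) ℚ[q]._+ₚ_ (ℚ[q].X ℚ[q].*ₚ_)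

weigh-coeff : ∀ φ p f → (∀ k → ℚ[q].coeff p k ≡ (+ f k) / 1) →
  ∀ k → ℚ[q].coeff (weigh φ p) k ≡ (+ (#weigh φ f k)) / 1
weigh-coeff initial p f p≡f k       = p≡f k
weigh-coeff falling p f p≡f k       = p≡f k
weigh-coeff rising  p f p≡f zero    = Coefficients.coeff-X-* p zero
weigh-coeff rising  p f p≡f (suc k) = trans (Coefficients.coeff-X-* p (suc k)) (p≡f k)

+-coeff : ∀ p r m n k → ℚ[q].coeff p k ≡ (+ m) / 1 → ℚ[q].coeff r k ≡ (+ n) / 1 →
  ℚ[q].coeff (p ℚ[q].+ₚ r) k ≡ (+ (m ℕ.+ n)) / 1
+-coeff p r m n k p≡ r≡ =
  trans (Coefficients.coeff-+ p r k) (trans (cong₂ ℚ._+_ p≡ r≡) (sym (+/1-homo-+ m n)))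

mutual

  -- Both instances of `Completions` obey the same recurrence, with multiplication by `q` matching
  -- `shift`, so they are compared clause by clause.
  completions-coeff : ∀ φ h r k →
    ℚ[q].coeff (completions φ h r) k ≡ (+ (#completions φ h r k)) / 1
  completions-coeff φ h r k = +-coeff (viaMin φ h r) (viaMax (afterMax φ) h r)
    (#viaMin φ h r k) (#viaMax (afterMax φ) h r k) k
    (viaMin-coeff φ h r k) (viaMax-coeff (afterMax φ) h r k)

  viaMin-coeff : ∀ φ h r k → ℚ[q].coeff (viaMin φ h r) k ≡ (+ (#viaMin φ h r k)) / 1
  viaMin-coeff φ zero    zero    zero    = refl
  viaMin-coeff φ zero    zero    (suc k) = refl
  viaMin-coeff φ zero    (suc r) k       = refl
  viaMin-coeff φ (suc h) r       k       =
    weigh-coeff φ (completions falling h r) (#completions falling h r) (completions-coeff falling h r) k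

  viaMax-coeff : ∀ φ h r k → ℚ[q].coeff (viaMax φ h r) k ≡ (+ (#viaMax φ h r k)) / 1
  viaMax-coeff φ h zero    k = refl
  viaMax-coeff φ h (suc r) k = +-coeff (completions φ h r) (viaMax φ (suc h) r)
    (#completions φ h r k) (#viaMax φ (suc h) r k) k
    (completions-coeff φ h r k) (viaMax-coeff φ (suc h) r k)

open QuadraticEquation seriesRing
private
  C : Series
  C = completions falling 0

theorem3 : ∃[ √Δ ] √Δ IsSqrtOf (- (4 · (z ^ 2 * q)) + 4 · (z ^ 2) + - (4 · z) + 1#) ×
    (∃[ f ] f IsQuotientOf (- 1# + √Δ) By (2 · (z * (z * q + - z + 1#))) ×
    (∀ n k → (+ (a^pk [321] n k)) / 1 ≡ [z^ n q^ k ] (1# + z * (- f) ^ 2)))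
-- The constant term of `√Δ` is a closed polynomial, so its comparison with 1 is a computation in
-- each degree of `q`.
theorem3 = √Δ q z C C-eq , ((λ { zero → refl ; (suc k) → refl }) , √Δ²≈Δ q z C C-eq) ,
  (- C) , -C*2zv≈√Δ-1 q z C C-eq , λ n k → begin
    (+ (a^pk [321] n k)) / 1                 ≡⟨ cong (λ a → (+ a) / 1) (a^pk≡#completions n k) ⟩
    (+ (#completions initial 0 n k)) / 1     ≡⟨ completions-coeff initial 0 n k ⟨
    ℚ[q].coeff (completions initial 0 n) k   ≡⟨ completions-initial n k ⟩
    [z^ n q^ k ] (1# + (z * C) * C)          ≡⟨ 1+zCC≈1+z[-[-C]]² q z C C-eq n k ⟩
    [z^ n q^ k ] (1# + z * (- (- C)) ^ 2)    ∎
  where open ≡-Reasoning
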